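{- Let $\mathcal{H}$ be a family of graphs. There is a constant $C=C(\mathcal{H})$ such that $$\#\{v\in V(G):\alpha(N(v))\ge 2\}\le C$$ for every $\mathcal{H}$-free graph $G$ if and only if $$\mathcal{H}\le\{K_n^*,\ nP_3,\ K_{1,n}^*,\ K_{2,n},\ E_2+K_n,\ CK_n\}$$ for some positive integer $n$.
   Context: All graphs are finite, undirected and simple (not necessarily connected). For graphs $H_1,H_2$, write $H_1\le H_2$ if $H_1$ is (isomorphic to) an induced subgraph of $H_2$. A graph $G$ is $\mathcal{H}$-free if there is no $H\in\mathcal{H}$ with $H\le G$. For families of graphs $\mathcal{H}_1,\mathcal{H}_2$, write $\mathcal{H}_1\le\mathcal{H}_2$ if for every $H_2\in\mathcal{H}_2$ there is $H_1\in\mathcal{H}_1$ with $H_1\le H_2$. $N(v)$ is the set of vertices of $G$ adjacent to $v$, and for $S\subset V(G)$, $\alpha(S)$ is the independence number of the induced subgraph $G[S]$. $K_n$ is the complete graph and $E_n$ the edgeless graph on $n$ vertices, $P_n$ the path on $n$ vertices, $K_{s,t}$ the complete bipartite graph. $G_1+G_2$ denotes the join of $G_1$ and $G_2$: the graph with vertex set $V(G_1)\sqcup V(G_2)$ whose edges are those of $G_1$, those of $G_2$, and all pairs $\{x,y\}$ with $x\in V(G_1)$, $y\in V(G_2)$. $nG$ denotes the disjoint union of $n$ copies of $G$. $K_{1,n}^*$ is obtained from the star $K_{1,n}$ by attaching one pendant vertex to each of its $n$ leaves. $K_n^*$ is obtained from $K_n$ by attaching one pendant vertex to every vertex of $K_n$.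 $CK_n$ is obtained from two disjoint copies of $K_n$ by adding a perfect matching between them. -}

module Defs where

open import Data.Empty using (⊥)
open import Data.Fin.Base using (Fin; toℕ)
open import Data.Fin.Properties using (_≟_; all?; +↔⊎; *↔×)
open import Data.Fin.Subset using (Subset; _∈_; ∣_∣; inside; outside)
open import Data.Fin.Subset.Properties using (_∈?_)
open import Data.List.Base as List using (List; []; _∷_; _++_; length; filter; allFin)
open import Data.List.Extrema.Nat using (max)
open import Data.List.Membership.Propositional using () renaming (_∈_ to _∈ᴸ_)
open import Data.Nat.Base using (ℕ; zero; suc)
import Data.Nat.Properties as ℕ
open import Data.Product.Base using (Σ; ∃; _×_; _,_; proj₂)
open import Data.Sum.Base using (_⊎_; inj₁; inj₂; swap)
open import Data.Unit.Base using (⊤; tt)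
open import Data.Vec.Base as Vec using ([]; _∷_)
open import Function.Base using (_∘_; _on_; id)
open import Function.Bundles using (_↔_; _⇔_; module Inverse)
open import Level using (Level; 0ℓ)
open import Relation.Binary.Core using (Rel)
open import Relation.Binary.Definitions
  using (Decidable; DecidableEquality; Symmetric)
open import Relation.Binary.PropositionalEquality using (_≡_; _≢_; refl; sym)
open import Relation.Nullary.Decidable
  using (Dec; yes; no; does; ¬?; _×-dec_; _⊎-dec_; _→-dec_)
open import Relation.Nullary.Negation using (¬_)
open import Relation.Unary as U using (Pred)

private
  variable
    ℓ ℓ′ : Level
    V W : Set

record SimpleGraph (V : Set) : Set₁ where
  infix 4 _~_ _~?_
  field
    _~_      : Rel V 0ℓ
    _~?_     : Decidable _~_
    ~-sym    : Symmetric _~_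
    ~-irrefl : ∀ {v} → ¬ (v ~ v)

-- For an injection f this is the subgraph induced on the image of f, relabelled.
comap : (V → W) → SimpleGraph W → SimpleGraph V
comap f G = record
  { _~_      = _~_ on f
  ; _~?_     = λ u v → f u ~? f v
  ; ~-sym    = ~-sym
  ; ~-irrefl = ~-irrefl
  } where open SimpleGraph G

record Graph : Set₁ where
  constructor mkGraph
  field
    order : ℕ
    graph : SimpleGraph (Fin order)
  open SimpleGraph graph public

open Graph using (order)

relabel : ∀ {n} → Fin n ↔ V → SimpleGraph V → Graph
relabel e G = mkGraph _ (comap (Inverse.to e) G)

⟨_⟩ : ∀ {n} {P : Pred (Fin n) ℓ} → U.Decidable P → Subset n
⟨ P? ⟩ = Vec.tabulate (does ∘ P?)

elements : ∀ {n} → Subset n → List (Fin n)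
elements S = filter (_∈? S) (allFin _)

subsets : ∀ n → List (Subset n)
subsets zero    = [] ∷ []
subsets (suc n) = List.map (inside ∷_) (subsets n) ++ List.map (outside ∷_) (subsets n)

infix 8 _[_]
_[_] : (G : Graph) → Subset (order G) → Graph
G [ S ] = mkGraph (length (elements S)) (comap (List.lookup (elements S)) (Graph.graph G))

infix 4 _≅_ _≤ᵢ_ _≤ᶠ_

_≅_ : Graph → Graph → Set
G ≅ H = Σ (Fin (order G) ↔ Fin (order H)) λ e →
        ∀ u v → Graph._~_ G u v ⇔ Graph._~_ H (Inverse.to e u) (Inverse.to e v)

_≤ᵢ_ : Graph → Graph → Set
H₁ ≤ᵢ H₂ = ∃ λ S → H₁ ≅ H₂ [ S ]

Family : (ℓ : Level) → Set _
Family ℓ = Pred Graph ℓ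

_-free_ : Family ℓ → Graph → Set _
𝓗 -free G = ¬ (∃ λ H → 𝓗 H × H ≤ᵢ G)

_≤ᶠ_ : Family ℓ → Family ℓ′ → Set _
𝓗₁ ≤ᶠ 𝓗₂ = ∀ H₂ → 𝓗₂ H₂ → ∃ λ H₁ → 𝓗₁ H₁ × H₁ ≤ᵢ H₂

module _ (G : Graph) where
  open Graph G using (_~_; _~?_)

  N : Fin (order G) → Subset (order G)
  N v = ⟨ v ~?_ ⟩

  Independent : Subset (order G) → Set
  Independent T = ∀ u v → u ∈ T → v ∈ T → ¬ (u ~ v)

  independent? : U.Decidable Independent
  independent? T = all? λ u → all? λ v → (u ∈? T) →-dec (v ∈? T) →-dec ¬? (u ~? v)

  independenceNumber : ℕ
  independenceNumber = max 0 (List.map ∣_∣ (filter independent? (subsets (order G))))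

α : (G : Graph) → Subset (order G) → ℕ
α G S = independenceNumber (G [ S ])

complete : ∀ n → SimpleGraph (Fin n)
complete n = record
  { _~_      = _≢_
  ; _~?_     = λ i j → ¬? (i ≟ j)
  ; ~-sym    = λ i≢j → i≢j ∘ sym
  ; ~-irrefl = λ i≢i → i≢i refl
  }

edgeless : ∀ n → SimpleGraph (Fin n)
edgeless n = record
  { _~_      = λ _ _ → ⊥
  ; _~?_     = λ _ _ → no id
  ; ~-sym    = id
  ; ~-irrefl = id
  }

path : ∀ n → SimpleGraph (Fin n)
path n = record
  { _~_      = λ i j → suc (toℕ i) ≡ toℕ j ⊎ suc (toℕ j) ≡ toℕ i
  ; _~?_     = λ i j → (suc (toℕ i) ℕ.≟ toℕ j) ⊎-dec (suc (toℕ j) ℕ.≟ toℕ i)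
  ; ~-sym    = swap
  ; ~-irrefl = λ { (inj₁ eq) → ℕ.1+n≢n eq ; (inj₂ eq) → ℕ.1+n≢n eq }
  }

-- Two graphs side by side, with the edges between them prescribed by R.
glue : SimpleGraph V → SimpleGraph W → {R : V → W → Set} →
       (∀ v w → Dec (R v w)) → SimpleGraph (V ⊎ W)
glue {V} {W} G H {R} R? = record
  { _~_      = _~_
  ; _~?_     = _~?_
  ; ~-sym    = λ {x} {y} → ~-sym x y
  ; ~-irrefl = λ {x} → ~-irrefl x
  }
  where
  module G = SimpleGraph G
  module H = SimpleGraph H

  _~_ : Rel (V ⊎ W) 0ℓ
  inj₁ v ~ inj₁ v′ = v G.~ v′
  inj₁ v ~ inj₂ w  = R v w
  inj₂ w ~ inj₁ v  = R v w
  inj₂ w ~ inj₂ w′ = w H.~ w′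

  _~?_ : Decidable _~_
  inj₁ v ~? inj₁ v′ = v G.~? v′
  inj₁ v ~? inj₂ w  = R? v w
  inj₂ w ~? inj₁ v  = R? v w
  inj₂ w ~? inj₂ w′ = w H.~? w′

  ~-sym : ∀ x y → x ~ y → y ~ x
  ~-sym (inj₁ _) (inj₁ _) = G.~-sym
  ~-sym (inj₁ _) (inj₂ _) = id
  ~-sym (inj₂ _) (inj₁ _) = id
  ~-sym (inj₂ _) (inj₂ _) = H.~-sym

  ~-irrefl : ∀ x → ¬ (x ~ x)
  ~-irrefl (inj₁ _) = G.~-irrefl
  ~-irrefl (inj₂ _) = H.~-irrefl

infixl 6 _⊹_
_⊹_ : SimpleGraph V → SimpleGraph W → SimpleGraph (V ⊎ W)
G ⊹ H = glue G H {λ _ _ → ⊤} (λ _ _ → yes tt)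

completeBipartite : ∀ s t → SimpleGraph (Fin s ⊎ Fin t)
completeBipartite s t = edgeless s ⊹ edgeless t

-- One new vertex for each i : Fin k, whose only neighbour is f i.
attachPendants : DecidableEquality V → ∀ {k} → (Fin k → V) → SimpleGraph V →
                 SimpleGraph (V ⊎ Fin k)
attachPendants _≟ⱽ_ f G = glue G (edgeless _) (λ v i → v ≟ⱽ f i)

copies : ∀ n → SimpleGraph V → SimpleGraph (Fin n × V)
copies n G = record
  { _~_      = λ (i , u) (j , v) → i ≡ j × u ~ v
  ; _~?_     = λ (i , u) (j , v) → (i ≟ j) ×-dec (u ~? v)
  ; ~-sym    = λ (i≡j , u~v) → sym i≡j , ~-sym u~v
  ; ~-irrefl = ~-irrefl ∘ proj₂
  } where open SimpleGraph G

K* : ℕ → Graph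
K* n = relabel +↔⊎ (attachPendants _≟_ id (complete n))

_P₃ : ℕ → Graph
n P₃ = relabel *↔× (copies n (path 3))

K*₁, : ℕ → Graph
K*₁, n = relabel +↔⊎ (attachPendants _≟_ leaf star)
  where
  star = Graph.graph (relabel (+↔⊎ {1} {n}) (completeBipartite 1 n))
  leaf = Inverse.from (+↔⊎ {1} {n}) ∘ inj₂

K₂, : ℕ → Graph
K₂, n = relabel +↔⊎ (completeBipartite 2 n)

E₂+K : ℕ → Graph
E₂+K n = relabel +↔⊎ (edgeless 2 ⊹ complete n)

CK : ℕ → Graph
CK n = relabel +↔⊎ (glue (complete n) (complete n) _≟_)

obstructions : ℕ → Family _
obstructions n = _∈ᴸ K* n ∷ n P₃ ∷ K*₁, n ∷ K₂, n ∷ E₂+K n ∷ CK n ∷ []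

module Submission where

{-
A vertex v has α(N(v)) ≥ 2 iff it is the middle of an induced path on three vertices.  Each
obstruction of parameter 2 + C has more than C such vertices, which gives one direction.

Conversely, take a long sequence of induced paths (aᵢ, vᵢ, bᵢ) with distinct middles and, by Ramsey,
make the adjacencies and equalities between the i-th and the j-th path (i < j) independent of i, j.
Two nonadjacent vertices with many common neighbours give K₂,ₙ or E₂ + Kₙ; this happens as soon as
some aᵢ ~ bⱼ with i ≢ j.  Otherwise, if one end x = aᵢ is adjacent to all (or all but one of) the vⱼ,
then either some bⱼ shares with x all these neighbours, or v and b are joined by a perfect matching
only, which gives Kₙ*, CKₙ, or, when both are independent, K*₁,ₙ with centre x.  In the remaining
case both v, a and v, b are joined by perfect matchings, which gives Kₙ*, CKₙ or nP₃.
-}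

open import Defs
open import Axiom.ExcludedMiddle using (ExcludedMiddle)
open import Data.Bool.Base using (Bool; true; false)
open import Data.Fin.Base as Fin using (Fin; zero; suc; fromℕ; inject₁; inject≤)
open import Data.Fin.Properties as Fin using (_≟_; any?; +↔⊎; *↔×; inject≤-injective)
open import Data.Fin.Subset using (Subset; _∈_; ∣_∣; inside; outside)
open import Data.Fin.Subset.Properties using (_∈?_; ⊆-antisym)
open import Data.List.Base as List using (List; []; _∷_; length; filter; allFin; take; tabulate; cartesianProduct)
open import Data.List.Extrema.Nat using (argmax-sel; v≤max⁺)
open import Data.List.Membership.Propositional using (lose) renaming (_∈_ to _∈ᴸ_)
open import Data.List.Membership.Propositional.Properties
  using ( ∈-filter⁺; ∈-filter⁻; ∈-allFin; ∈-lookup; ∈-map⁺; ∈-map⁻; ∈-++⁺ˡ; ∈-++⁺ʳ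
        ; ∈-cartesianProduct⁺)
open import Data.List.Properties using (length-take; length-tabulate)
open import Data.List.Relation.Binary.Sublist.Propositional using (_⊆_; []; _∷_; _∷ʳ_; ⊆-trans; minimum)
open import Data.List.Relation.Binary.Sublist.Propositional.Properties
  using (All-resp-⊆; filter-⊆; take-⊆)
open import Data.List.Relation.Unary.All as All using (All; []; _∷_)
open import Data.List.Relation.Unary.All.Properties using (all-filter)
open import Data.List.Relation.Unary.AllPairs using (AllPairs; []; _∷_)
open import Data.List.Relation.Unary.Any using (here; there; index)
open import Data.List.Relation.Unary.Any.Properties using (lookup-index)
open import Data.List.Relation.Unary.Unique.Propositional.Properties as Unique using ()
open import Data.Nat.Base using (ℕ; zero; suc; _+_; _≤_; _<_; _≥_; z≤n; s≤s; s<s)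
open import Data.Nat.Properties as ℕ using (_≤?_)
open import Data.Product.Base using (∃; ∃₂; _×_; _,_; proj₁; proj₂; map₂)
open import Data.Sum.Base as Sum using (_⊎_; inj₁; inj₂)
open import Data.Sum.Properties using (inj₁-injective; inj₂-injective)
open import Data.Vec.Base using ([]; _∷_)
open import Data.Vec.Properties using (lookup∘tabulate; lookup⇒[]=; []=⇒lookup)
open import Function.Base using (_∘_; id)
open import Function.Bundles using (_↔_; _⇔_; mk⇔; mk↔ₛ′; module Inverse; module Injection; module Equivalence)
open import Function.Definitions using (Injective)
open import Function.Properties.Inverse using (↔⇒↣; ↔-sym)
open import Level using (Level; _⊔_; 0ℓ) renaming (suc to lsuc)
open import Relation.Binary.Core using (Rel)
open import Relation.Binary.Definitions using (Decidable; tri<; tri≈; tri>)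
open import Relation.Binary.PropositionalEquality
  using (_≡_; _≢_; refl; sym; trans; cong; subst; subst₂)
open import Relation.Nullary.Decidable using (Dec; yes; no; does; dec-true; decidable-stable)
open import Relation.Nullary.Negation using (¬_; contradiction)
open import Relation.Unary as U using (Pred)
open import Relation.Unary.Properties using (∁?)

open Graph using (order; graph)

private
  variable
    ℓ : Level
    k m n : ℕ
    A I V W X : Set

-- Ramsey's theorem

AllPairs-resp-⊆ : {R : Rel A 0ℓ} {xs ys : List A} → ys ⊆ xs → AllPairs R xs → AllPairs R ys
AllPairs-resp-⊆ []           []         = []
AllPairs-resp-⊆ (x ∷ʳ ys⊆xs) (_ ∷ pxs)  = AllPairs-resp-⊆ ys⊆xs pxs
AllPairs-resp-⊆ (refl ∷ ys⊆xs) (px ∷ pxs) = All-resp-⊆ ys⊆xs px ∷ AllPairs-resp-⊆ ys⊆xs pxs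

AllPairs-lookup : {R : Rel A 0ℓ} {xs : List A} → AllPairs R xs →
                  ∀ {i j} → i Fin.< j → R (List.lookup xs i) (List.lookup xs j)
AllPairs-lookup (px ∷ pxs) {zero}  {suc j} _         = All.lookup px (∈-lookup j)
AllPairs-lookup (px ∷ pxs) {suc i} {suc j} (s<s i<j) = AllPairs-lookup pxs i<j

increasing⇒injective : {f : Fin n → A} → (∀ {i j} → i Fin.< j → f i ≢ f j) → Injective _≡_ _≡_ f
increasing⇒injective f≢ {i} {j} eq with Fin.<-cmp i j
... | tri< i<j _ _ = contradiction eq (f≢ i<j)
... | tri≈ _ i≡j _ = i≡j
... | tri> _ _ j<i = contradiction (sym eq) (f≢ j<i)

length-filter-∁ : {P : Pred A 0ℓ} (P? : U.Decidable P) (xs : List A) →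
                  length xs ≡ length (filter P? xs) + length (filter (∁? P?) xs)
length-filter-∁ P? []       = refl
length-filter-∁ P? (x ∷ xs) with does (P? x)
... | true  = cong suc (length-filter-∁ P? xs)
... | false = trans (cong suc (length-filter-∁ P? xs)) (sym (ℕ.+-suc _ _))

+-split-≤ : ∀ a b {c d} → a + b ≤ c + d → a ≤ c ⊎ b ≤ d
+-split-≤ a b {c} {d} a+b≤c+d with a ≤? c
... | yes a≤c = inj₁ a≤c
... | no  a≰c = inj₂ (ℕ.≮⇒≥ λ d<b → ℕ.<⇒≱ (ℕ.+-mono-< (ℕ.≰⇒> a≰c) d<b) a+b≤c+d)

-- An upper bound from the recursion that removes one element, not the exact Ramsey number; the
-- extra `suc` pays for the removed element.
ramseyNumber : ℕ → ℕ → ℕ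
ramseyNumber zero    q       = 0
ramseyNumber (suc p) zero    = 0
ramseyNumber (suc p) (suc q) = suc (ramseyNumber p (suc q) + ramseyNumber (suc p) q)

-- Split the tail by whether the head `x` is related to each element. One part is large enough for
-- the induction, and `x` is put in front when the sublist found there has the matching colour. `R`
-- may be asymmetric, since `AllPairs` compares elements in list order only.
ramsey : {R : Rel A 0ℓ} → Decidable R → ∀ p q (xs : List A) → ramseyNumber p q ≤ length xs →
         ∃ λ ys → ys ⊆ xs ×
           ((length ys ≡ p × AllPairs R ys) ⊎ (length ys ≡ q × AllPairs (λ x y → ¬ R x y) ys))
ramsey R? zero    q       xs _ = [] , minimum xs , inj₁ (refl , [])
ramsey R? (suc p) zero    xs _ = [] , minimum xs , inj₂ (refl , [])
ramsey R? (suc p) (suc q) (x ∷ xs) (s≤s large)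
  with +-split-≤ (ramseyNumber p (suc q)) _ (subst (_ ≤_) (length-filter-∁ (R? x) xs) large)
... | inj₁ large₁ with ramsey R? p (suc q) _ large₁
...   | ys , ys⊆ , inj₁ (len , pys) =
        x ∷ ys , refl ∷ ⊆-trans ys⊆ (filter-⊆ (R? x) xs) ,
        inj₁ (cong suc len , All-resp-⊆ ys⊆ (all-filter (R? x) xs) ∷ pys)
...   | ys , ys⊆ , inj₂ res = ys , x ∷ʳ ⊆-trans ys⊆ (filter-⊆ (R? x) xs) , inj₂ res
ramsey R? (suc p) (suc q) (x ∷ xs) (s≤s large)
    | inj₂ large₂ with ramsey R? (suc p) q _ large₂
...   | ys , ys⊆ , inj₁ res = ys , x ∷ʳ ⊆-trans ys⊆ (filter-⊆ (∁? (R? x)) xs) , inj₁ res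
...   | ys , ys⊆ , inj₂ (len , pys) =
        x ∷ ys , refl ∷ ⊆-trans ys⊆ (filter-⊆ (∁? (R? x)) xs) ,
        inj₂ (cong suc len , All-resp-⊆ ys⊆ (all-filter (∁? (R? x)) xs) ∷ pys)

-- Subsequences on which several relations are uniform

Forward : (V → W → Set) → (Fin m → V) → (Fin m → W) → Set
Forward R x y = ∀ {i j} → i Fin.< j → R (x i) (y j)

-- The diagonal is left open. For symmetric `R`, pairs with the larger index on the left are reached
-- by exchanging `x` and `y`.
Uniform : (V → W → Set) → (Fin m → V) → (Fin m → W) → Set
Uniform R x y = Forward R x y ⊎ Forward (λ u w → ¬ R u w) x y

iteratedRamseyNumber : ℕ → ℕ → ℕ
iteratedRamseyNumber zero    m = m
iteratedRamseyNumber (suc r) m = ramseyNumber p p where p = iteratedRamseyNumber r m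

-- One application of Ramsey's theorem per relation, each inside the previous sublist. Sublists keep
-- the order, so what earlier rounds achieved survives; at the end the list is cut to length `m`.
iteratedRamsey : {R : I → Rel A 0ℓ} → (∀ k → Decidable (R k)) →
                 ∀ ks m (xs : List A) → iteratedRamseyNumber (length ks) m ≤ length xs →
                 ∃ λ ys → ys ⊆ xs × length ys ≡ m ×
                   All (λ k → AllPairs (R k) ys ⊎ AllPairs (λ x y → ¬ R k x y) ys) ks
iteratedRamsey R? []       m xs large =
  take m xs , take-⊆ m xs , trans (length-take m xs) (ℕ.m≤n⇒m⊓n≡m large) , []
iteratedRamsey {A = A} {R = R} R? (k ∷ ks) m xs large with ramsey (R? k) p p xs large
  where p = iteratedRamseyNumber (length ks) m
... | ys , ys⊆ , homogeneous = refine (merge homogeneous)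
  where
  p = iteratedRamseyNumber (length ks) m
  R̄ : Rel A 0ℓ
  R̄ x y = ¬ R k x y
  merge : (length ys ≡ p × AllPairs (R k) ys) ⊎ (length ys ≡ p × AllPairs R̄ ys) →
          length ys ≡ p × (AllPairs (R k) ys ⊎ AllPairs R̄ ys)
  merge (inj₁ (len , pys)) = len , inj₁ pys
  merge (inj₂ (len , pys)) = len , inj₂ pys
  refine : length ys ≡ p × (AllPairs (R k) ys ⊎ AllPairs R̄ ys) → _
  refine (len , pys) with iteratedRamsey R? ks m ys (ℕ.≤-reflexive (sym len))
  ... | zs , zs⊆ , len′ , pzs =
    zs , ⊆-trans zs⊆ ys⊆ , len′ ,
    Sum.map (AllPairs-resp-⊆ zs⊆) (AllPairs-resp-⊆ zs⊆) pys ∷ pzs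

-- Ramsey is applied to the list of indices. A sublist of `allFin k` has no repetitions, so looking
-- up in it is injective.
uniformSubsequence : {R : I → Rel (Fin k) 0ℓ} → (∀ c → Decidable (R c)) →
                     ∀ cs m → iteratedRamseyNumber (length cs) m ≤ k →
                     ∃ λ (t : Fin m → Fin k) → Injective _≡_ _≡_ t ×
                       (∀ {c} → c ∈ᴸ cs → Uniform (R c) t t)
uniformSubsequence {k = k} R? cs m large
  with iteratedRamsey R? cs m (allFin k) (subst (_ ≤_) (sym (length-tabulate {n = k} id)) large)
... | ys , ys⊆ , refl , pys =
  List.lookup ys ,
  increasing⇒injective (AllPairs-lookup (AllPairs-resp-⊆ ys⊆ (Unique.allFin⁺ k))) ,
  λ c∈cs → Sum.map (λ p {_} {_} → AllPairs-lookup p) (λ p {_} {_} → AllPairs-lookup p)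
                   (All.lookup pys c∈cs)

-- Enumeration of subsets

private
  variable
    P : Pred (Fin n) ℓ

∈⟨⟩⁺ : (P? : U.Decidable P) → ∀ {x} → P x → x ∈ ⟨ P? ⟩
∈⟨⟩⁺ P? {x} px =
  lookup⇒[]= x ⟨ P? ⟩ (trans (lookup∘tabulate (does ∘ P?) x) (dec-true (P? x) px))

∈⟨⟩⁻ : (P? : U.Decidable P) → ∀ {x} → x ∈ ⟨ P? ⟩ → P x
∈⟨⟩⁻ P? {x} x∈ with P? x | trans (sym (lookup∘tabulate (does ∘ P?) x)) ([]=⇒lookup x∈)
... | yes px | _  = px
... | no  _  | ()

module _ (S : Subset n) where

  element : Fin (length (elements S)) → Fin n
  element = List.lookup (elements S)

  element∈ : ∀ i → element i ∈ S
  element∈ i = proj₂ (∈-filter⁻ (_∈? S) {xs = allFin n} (∈-lookup i))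

  rank : ∀ {x} → x ∈ S → Fin (length (elements S))
  rank x∈S = index (∈-filter⁺ (_∈? S) (∈-allFin _) x∈S)

  element-rank : ∀ {x} (x∈S : x ∈ S) → element (rank x∈S) ≡ x
  element-rank x∈S = sym (lookup-index (∈-filter⁺ (_∈? S) (∈-allFin _) x∈S))

  element-injective : Injective _≡_ _≡_ element
  element-injective =
    increasing⇒injective (AllPairs-lookup (Unique.filter⁺ (_∈? S) (Unique.allFin⁺ n)))

  length-elements : length (elements S) ≡ ∣ S ∣
  length-elements = trans (count id (_∈? S)) (cong ∣_∣ (⊆-antisym (∈⟨⟩⁻ (_∈? S)) (∈⟨⟩⁺ (_∈? S))))
    where
    -- Stated for `tabulate f`, because the tail of `allFin` is the tabulation of `suc`.
    count : (f : Fin m → A) {P : Pred A 0ℓ} (P? : U.Decidable P) →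
            length (filter P? (tabulate f)) ≡ ∣ ⟨ P? ∘ f ⟩ ∣
    count {m = zero}  f P? = refl
    count {m = suc m} f P? with does (P? (f zero))
    ... | true  = cong suc (count (f ∘ suc) P?)
    ... | false = count (f ∘ suc) P?

  ≤∣∣⇒injection : k ≤ ∣ S ∣ → ∃ λ (f : Fin k → Fin n) → Injective _≡_ _≡_ f × ∀ i → f i ∈ S
  ≤∣∣⇒injection k≤∣S∣ =
    element ∘ (λ i → inject≤ i k≤length) ,
    (λ eq → inject≤-injective k≤length k≤length _ _ (element-injective eq)) ,
    λ i → element∈ _
    where k≤length = subst (_ ≤_) (sym length-elements) k≤∣S∣

  injection⇒≤∣∣ : (f : Fin k → Fin n) → Injective _≡_ _≡_ f → (∀ i → f i ∈ S) → k ≤ ∣ S ∣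
  injection⇒≤∣∣ f f-inj f∈S = subst (_ ≤_) length-elements
    (Fin.injective⇒≤ λ {i} {j} eq → f-inj
      (trans (sym (element-rank (f∈S i))) (trans (cong element eq) (element-rank (f∈S j)))))


-- Embeddings

infix 4 _↪_

-- Induced containment as a map. Vertex types are arbitrary, so the obstructions can be treated on
-- sums and products, before they are relabelled by `Fin`.
record _↪_ (G : SimpleGraph V) (H : SimpleGraph W) : Set where
  private
    module G = SimpleGraph G
    module H = SimpleGraph H
  field
    to        : V → W
    injective : Injective _≡_ _≡_ to
    preserves : ∀ {u v} → u G.~ v → to u H.~ to v
    reflects  : ∀ {u v} → to u H.~ to v → u G.~ v

open _↪_

private
  variable
    G : SimpleGraph V
    H : SimpleGraph W
    K : SimpleGraph X

↪-trans : G ↪ H → H ↪ K → G ↪ K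
↪-trans f g = record
  { to        = to g ∘ to f
  ; injective = injective f ∘ injective g
  ; preserves = preserves g ∘ preserves f
  ; reflects  = reflects f ∘ reflects g
  }

comap-↪ : {h : V → W} → Injective _≡_ _≡_ h → comap h H ↪ H
comap-↪ {h = h} h-inj = record { to = h ; injective = h-inj ; preserves = id ; reflects = id }

relabel-↪ : (e : Fin n ↔ V) → graph (relabel e G) ↪ G
relabel-↪ e = comap-↪ (Injection.injective (↔⇒↣ e))

↪-relabel : (e : Fin n ↔ V) → G ↪ graph (relabel e G)
↪-relabel {G = G} e = record
  { to        = from
  ; injective = Injection.injective (↔⇒↣ (↔-sym e))
  ; preserves = subst₂ _~_ (sym (strictlyInverseˡ _)) (sym (strictlyInverseˡ _))
  ; reflects  = subst₂ _~_ (strictlyInverseˡ _) (strictlyInverseˡ _)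
  }
  where
  open Inverse e using (from; strictlyInverseˡ)
  open SimpleGraph G

≤ᵢ⇒↪ : ∀ {A B} → A ≤ᵢ B → graph A ↪ graph B
≤ᵢ⇒↪ {A} {B} (S , e , iso) = ↪-trans A↪B[S] (comap-↪ (element-injective S))
  where
  A↪B[S] : graph A ↪ graph (B [ S ])
  A↪B[S] = record
    { to        = Inverse.to e
    ; injective = Injection.injective (↔⇒↣ e)
    ; preserves = Equivalence.to (iso _ _)
    ; reflects  = Equivalence.from (iso _ _)
    }

-- The induced subgraph lives on the image of `f`, a decidable subset because the domain is finite;
-- the search that decides membership also supplies the inverse.
↪⇒≤ᵢ : ∀ {A B} → graph A ↪ graph B → A ≤ᵢ B
↪⇒≤ᵢ {A} {B} f = S , mk↔ₛ′ forth back forth∘back back∘forth , λ u v →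
  mk⇔ (subst₂ _~_ (sym (element-forth u)) (sym (element-forth v)) ∘ preserves f)
      (reflects f ∘ subst₂ _~_ (element-forth u) (element-forth v))
  where
  open Graph B using (_~_)
  image? : U.Decidable (λ x → ∃ λ u → to f u ≡ x)
  image? x = any? λ u → to f u ≟ x
  S = ⟨ image? ⟩
  f∈S : ∀ u → to f u ∈ S
  f∈S u = ∈⟨⟩⁺ image? (u , refl)
  forth : Fin (order A) → Fin (length (elements S))
  forth u = rank S (f∈S u)
  preimage : ∀ i → ∃ λ u → to f u ≡ element S i
  preimage i = ∈⟨⟩⁻ image? (element∈ S i)
  back : Fin (length (elements S)) → Fin (order A)
  back = proj₁ ∘ preimage
  element-forth : ∀ u → element S (forth u) ≡ to f u
  element-forth u = element-rank S (f∈S u)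
  forth∘back : ∀ i → forth (back i) ≡ i
  forth∘back i = element-injective S (trans (element-forth (back i)) (proj₂ (preimage i)))
  back∘forth : ∀ u → back (forth u) ≡ u
  back∘forth u = injective f (trans (proj₂ (preimage (forth u))) (element-forth u))

-- Induced paths on three vertices

module _ (G : SimpleGraph V) where
  open SimpleGraph G

  -- The middle differs from both ends because adjacency is irreflexive.
  P₃ : ∀ {x v y} → x ~ v → v ~ y → x ≢ y → ¬ (x ~ y) → path 3 ↪ G
  P₃ {x} {v} {y} x~v v~y x≢y x≁y = record
    { to        = vertex
    ; injective = λ {i} {j} → inj i j
    ; preserves = λ {i} {j} → pres i j
    ; reflects  = λ {i} {j} → reflect i j
    }
    where
    vertex : Fin 3 → V
    vertex zero             = x
    vertex (suc zero)       = v
    vertex (suc (suc zero)) = y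
    ~⇒≢ : ∀ {u w} → u ~ w → u ≢ w
    ~⇒≢ u~w refl = ~-irrefl u~w
    inj : ∀ i j → vertex i ≡ vertex j → i ≡ j
    inj zero             zero             _  = refl
    inj zero             (suc zero)       eq = contradiction eq (~⇒≢ x~v)
    inj zero             (suc (suc zero)) eq = contradiction eq x≢y
    inj (suc zero)       zero             eq = contradiction (sym eq) (~⇒≢ x~v)
    inj (suc zero)       (suc zero)       _  = refl
    inj (suc zero)       (suc (suc zero)) eq = contradiction eq (~⇒≢ v~y)
    inj (suc (suc zero)) zero             eq = contradiction (sym eq) x≢y
    inj (suc (suc zero)) (suc zero)       eq = contradiction (sym eq) (~⇒≢ v~y)
    inj (suc (suc zero)) (suc (suc zero)) _  = refl
    pres : ∀ i j → SimpleGraph._~_ (path 3) i j → vertex i ~ vertex j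
    pres zero             (suc zero)       _ = x~v
    pres (suc zero)       zero             _ = ~-sym x~v
    pres (suc zero)       (suc (suc zero)) _ = v~y
    pres (suc (suc zero)) (suc zero)       _ = ~-sym v~y
    pres zero             zero             (inj₁ ())
    pres zero             zero             (inj₂ ())
    pres zero             (suc (suc zero)) (inj₁ ())
    pres zero             (suc (suc zero)) (inj₂ ())
    pres (suc zero)       (suc zero)       (inj₁ ())
    pres (suc zero)       (suc zero)       (inj₂ ())
    pres (suc (suc zero)) zero             (inj₁ ())
    pres (suc (suc zero)) zero             (inj₂ ())
    pres (suc (suc zero)) (suc (suc zero)) (inj₁ ())
    pres (suc (suc zero)) (suc (suc zero)) (inj₂ ())
    reflect : ∀ i j → vertex i ~ vertex j → SimpleGraph._~_ (path 3) i j
    reflect zero             (suc zero)       _  = inj₁ refl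
    reflect (suc zero)       zero             _  = inj₂ refl
    reflect (suc zero)       (suc (suc zero)) _  = inj₁ refl
    reflect (suc (suc zero)) (suc zero)       _  = inj₂ refl
    reflect zero             zero             lp = contradiction lp ~-irrefl
    reflect (suc zero)       (suc zero)       lp = contradiction lp ~-irrefl
    reflect (suc (suc zero)) (suc (suc zero)) lp = contradiction lp ~-irrefl
    reflect zero             (suc (suc zero)) e  = contradiction e x≁y
    reflect (suc (suc zero)) zero             e  = contradiction (~-sym e) x≁y

pattern left   = zero
pattern middle = suc zero
pattern right  = suc (suc zero)

module _ {G : SimpleGraph V} (p : path 3 ↪ G) where
  open SimpleGraph G

  left~middle : to p left ~ to p middle
  left~middle = preserves p (inj₁ refl)

  middle~right : to p middle ~ to p right
  middle~right = preserves p (inj₁ refl)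

  left≢right : to p left ≢ to p right
  left≢right eq with injective p eq
  ... | ()

  left≁right : ¬ (to p left ~ to p right)
  left≁right e with reflects p {left} {right} e
  ... | inj₁ ()
  ... | inj₂ ()

-- Stands in for α(N(v)) ≥ 2: two nonadjacent neighbours of `v` are the ends of such a path. In this
-- form the property passes along embeddings.
IsCentre : (G : SimpleGraph V) → V → Set
IsCentre G v = ∃ λ (p : path 3 ↪ G) → to p middle ≡ v

centre-↪ : ∀ {v} (f : G ↪ H) → IsCentre G v → IsCentre H (to f v)
centre-↪ f (p , eq) = ↪-trans p f , cong (to f) eq

∈-subsets : (T : Subset n) → T ∈ᴸ subsets n
∈-subsets []              = here refl
∈-subsets (inside ∷ T)    = ∈-++⁺ˡ (∈-map⁺ (inside ∷_) (∈-subsets T))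
∈-subsets {suc n} (outside ∷ T) =
  ∈-++⁺ʳ (List.map (inside ∷_) (subsets n)) (∈-map⁺ (outside ∷_) (∈-subsets T))

module _ (G : Graph) where
  open Graph G using (_~_; _~?_; ~-sym; ~-irrefl)

  module _ (S : Subset (order G)) where

    2≤α⇒nonadjacent-pair : 2 ≤ α G S → ∃₂ λ x y → x ∈ S × y ∈ S × x ≢ y × ¬ (x ~ y)
    2≤α⇒nonadjacent-pair 2≤α with argmax-sel id 0 sizes
      where sizes = List.map ∣_∣ (filter (independent? (G [ S ])) (subsets (order (G [ S ]))))
    -- The maximum is either its default value 0, which `2≤α` excludes, or the size of some listed
    -- independent set.
    ... | inj₁ α≡0 = contradiction (subst (2 ≤_) α≡0 2≤α) λ ()
    ... | inj₂ α∈  with ∈-map⁻ ∣_∣ α∈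
    ...   | T , T∈ , α≡∣T∣
          with ∈-filter⁻ (independent? (G [ S ])) {xs = subsets (order (G [ S ]))} T∈
             | ≤∣∣⇒injection T (subst (2 ≤_) α≡∣T∣ 2≤α)
    ...     | _ , indep | f , f-inj , f∈T =
      element S (f zero) , element S (f (suc zero)) , element∈ S _ , element∈ S _ ,
      (λ eq → contradiction (f-inj (element-injective S eq)) λ ()) ,
      indep _ _ (f∈T _) (f∈T _)

    nonadjacent-pair⇒2≤α : ∀ {x y} → x ∈ S → y ∈ S → x ≢ y → ¬ (x ~ y) → 2 ≤ α G S
    nonadjacent-pair⇒2≤α {x} {y} x∈S y∈S x≢y x≁y =
      v≤max⁺ 0 _ (inj₂ (lose
        (∈-map⁺ ∣_∣ (∈-filter⁺ (independent? (G [ S ])) (∈-subsets T) indep)) 2≤∣T∣))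
      where
      pair : Fin 2 → Fin (length (elements S))
      pair zero       = rank S x∈S
      pair (suc zero) = rank S y∈S
      ranks≢ : rank S x∈S ≢ rank S y∈S
      ranks≢ eq = x≢y
        (trans (sym (element-rank S x∈S)) (trans (cong (element S) eq) (element-rank S y∈S)))
      pair-injective : Injective _≡_ _≡_ pair
      pair-injective {zero}     {zero}     _  = refl
      pair-injective {zero}     {suc zero} eq = contradiction eq ranks≢
      pair-injective {suc zero} {zero}     eq = contradiction (sym eq) ranks≢
      pair-injective {suc zero} {suc zero} _  = refl
      inPair? = λ i → any? λ j → pair j ≟ i
      T = ⟨ inPair? ⟩
      2≤∣T∣ : 2 ≤ ∣ T ∣
      2≤∣T∣ = injection⇒≤∣∣ T pair pair-injective λ j → ∈⟨⟩⁺ inPair? (j , refl)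
      ranks≁ : ¬ (element S (rank S x∈S) ~ element S (rank S y∈S))
      ranks≁ e = x≁y (subst₂ _~_ (element-rank S x∈S) (element-rank S y∈S) e)
      nonadjacent : ∀ i j → ¬ (element S (pair i) ~ element S (pair j))
      nonadjacent zero       zero       e = ~-irrefl e
      nonadjacent zero       (suc zero) e = ranks≁ e
      nonadjacent (suc zero) zero       e = ranks≁ (~-sym e)
      nonadjacent (suc zero) (suc zero) e = ~-irrefl e
      indep : Independent (G [ S ]) T
      indep u w u∈T w∈T with ∈⟨⟩⁻ inPair? u∈T | ∈⟨⟩⁻ inPair? w∈T
      ... | i , refl | j , refl = nonadjacent i j

  branching? : U.Decidable (λ v → 2 ≤ α G (N G v))
  branching? v = 2 ≤? α G (N G v)

  branching⇒centre : ∀ {v} → 2 ≤ α G (N G v) → IsCentre (graph G) v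
  branching⇒centre {v} 2≤α with 2≤α⇒nonadjacent-pair (N G v) 2≤α
  ... | x , y , x∈N , y∈N , x≢y , x≁y =
    P₃ (graph G) (~-sym (∈⟨⟩⁻ (v ~?_) x∈N)) (∈⟨⟩⁻ (v ~?_) y∈N) x≢y x≁y , refl

  centre⇒branching : ∀ {v} → IsCentre (graph G) v → 2 ≤ α G (N G v)
  centre⇒branching (p , refl) = nonadjacent-pair⇒2≤α (N G (to p middle))
    (∈⟨⟩⁺ (to p middle ~?_) (~-sym (left~middle p))) (∈⟨⟩⁺ (to p middle ~?_) (middle~right p))
    (left≢right p) (left≁right p)

-- Embeddings of the obstructions

↪-glue : {R : V → W → Set} {R? : ∀ v w → Dec (R v w)} (f : G ↪ K) (g : H ↪ K) →
         (∀ v w → to f v ≢ to g w) →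
         (∀ {v w} → R v w → SimpleGraph._~_ K (to f v) (to g w)) →
         (∀ {v w} → SimpleGraph._~_ K (to f v) (to g w) → R v w) →
         glue G H R? ↪ K
↪-glue {V = V} {W = W} {G = G} {K = K} {H = H} {R? = R?} f g f≢g R⇒~ ~⇒R = record
  { to        = Sum.[ to f , to g ]
  ; injective = λ {x} {y} → inj x y
  ; preserves = λ {x} {y} → pres x y
  ; reflects  = λ {x} {y} → reflect x y
  }
  where
  open SimpleGraph K
  h : V ⊎ W → _
  h = Sum.[ to f , to g ]
  inj : ∀ x y → h x ≡ h y → x ≡ y
  inj (inj₁ v) (inj₁ v′) eq = cong inj₁ (injective f eq)
  inj (inj₁ v) (inj₂ w)  eq = contradiction eq (f≢g v w)
  inj (inj₂ w) (inj₁ v)  eq = contradiction (sym eq) (f≢g v w)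
  inj (inj₂ w) (inj₂ w′) eq = cong inj₂ (injective g eq)
  pres : ∀ x y → SimpleGraph._~_ (glue G H R?) x y → h x ~ h y
  pres (inj₁ _) (inj₁ _) e = preserves f e
  pres (inj₁ _) (inj₂ _) r = R⇒~ r
  pres (inj₂ _) (inj₁ _) r = ~-sym (R⇒~ r)
  pres (inj₂ _) (inj₂ _) e = preserves g e
  reflect : ∀ x y → h x ~ h y → SimpleGraph._~_ (glue G H R?) x y
  reflect (inj₁ _) (inj₁ _) e = reflects f e
  reflect (inj₁ _) (inj₂ _) e = ~⇒R e
  reflect (inj₂ _) (inj₁ _) e = ~⇒R (~-sym e)
  reflect (inj₂ _) (inj₂ _) e = reflects g e

-- The images are disjoint, since a common vertex would be adjacent to itself.
↪-⊹ : (f : G ↪ K) (g : H ↪ K) →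
      (∀ v w → SimpleGraph._~_ K (to f v) (to g w)) → (G ⊹ H) ↪ K
↪-⊹ {K = K} f g f~g = ↪-glue f g
  (λ v w eq → SimpleGraph.~-irrefl K (subst (λ x → SimpleGraph._~_ K x (to g w)) eq (f~g v w)))
  (λ _ → f~g _ _) _

-- The hypothesis that H has no isolated vertex makes the copies disjoint.
↪-copies : (f : Fin n → H ↪ G) → (∀ u → ∃ λ w → SimpleGraph._~_ H w u) →
           (∀ {i j} → i ≢ j → ∀ u w → ¬ SimpleGraph._~_ G (to (f i) u) (to (f j) w)) →
           copies n H ↪ G
↪-copies {G = G} f neighbour f≁f = record
  { to        = λ (i , u) → to (f i) u
  ; injective = inj
  ; preserves = λ { (refl , e) → preserves (f _) e }
  ; reflects  = reflect
  }
  where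
  open SimpleGraph G
  inj : Injective _≡_ _≡_ (λ (i , u) → to (f i) u)
  inj {i , u} {j , w} eq with i ≟ j
  ... | yes refl = cong (i ,_) (injective (f i) eq)
  ... | no  i≢j  = contradiction
    (subst (to (f i) (proj₁ (neighbour u)) ~_) eq (preserves (f i) (proj₂ (neighbour u))))
    (f≁f i≢j _ w)
  reflect : ∀ {x y} → to (f (proj₁ x)) (proj₂ x) ~ to (f (proj₁ y)) (proj₂ y) → _
  reflect {i , u} {j , w} e with i ≟ j
  ... | yes refl = refl , reflects (f i) e
  ... | no  i≢j  = contradiction e (f≁f i≢j u w)

-- Cliques, stable sequences and matchings

module Sequences (G : SimpleGraph V) where
  open SimpleGraph G

  Clique Stable Homogeneous : (Fin m → V) → Set
  Clique x = ∀ {i j} → i ≢ j → x i ~ x j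
  Stable x = ∀ i j → ¬ (x i ~ x j)
  Homogeneous x = Clique x ⊎ Stable x

  homogeneous-∘ : {x : Fin m → V} {h : Fin n → Fin m} → Injective _≡_ _≡_ h →
                  Homogeneous x → Homogeneous (x ∘ h)
  homogeneous-∘ h-inj (inj₁ clique) = inj₁ λ i≢j → clique (i≢j ∘ h-inj)
  homogeneous-∘ h-inj (inj₂ stable) = inj₂ λ i j → stable _ _

  -- A repeated vertex would be adjacent to itself. A stable sequence can repeat vertices, hence the
  -- extra hypothesis of `stable-↪`.
  clique-↪ : {x : Fin m → V} → Clique x → complete m ↪ G
  clique-↪ {x = x} clique = record
    { to        = x
    ; injective = λ {i} {j} eq → decidable-stable (i ≟ j) λ i≢j →
                    ~-irrefl (subst (x i ~_) (sym eq) (clique i≢j))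
    ; preserves = clique
    ; reflects  = λ { e refl → ~-irrefl e }
    }

  stable-↪ : {x : Fin m → V} → Injective _≡_ _≡_ x → Stable x → edgeless m ↪ G
  stable-↪ {x = x} x-inj stable = record
    { to = x ; injective = x-inj ; preserves = λ () ; reflects = stable _ _ }

  nonadjacent-↪ : ∀ {x y} → x ≢ y → ¬ (x ~ y) → edgeless 2 ↪ G
  nonadjacent-↪ {x} {y} x≢y x≁y = record
    { to        = λ { zero → x ; (suc _) → y }
    ; injective = λ { {zero} {zero} _ → refl ; {zero} {suc zero} eq → contradiction eq x≢y
                    ; {suc zero} {zero} eq → contradiction (sym eq) x≢y
                    ; {suc zero} {suc zero} _ → refl }
    ; preserves = λ ()
    ; reflects  = λ { {zero} {zero} → ~-irrefl ; {zero} {suc zero} → x≁y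
                    ; {suc zero} {zero} → x≁y ∘ ~-sym ; {suc zero} {suc zero} → ~-irrefl }
    }

  -- `Forward` puts the smaller index first, so the pairs `j < i` are covered by the hypothesis with
  -- the two sequences exchanged.
  offDiagonal : {R : V → V → Set} {x y : Fin m → V} → Forward (λ u w → ¬ R u w) x y →
                Forward (λ u w → ¬ R w u) y x → ∀ {i j} → i ≢ j → ¬ R (x i) (y j)
  offDiagonal fwd bwd {i} {j} i≢j with Fin.<-cmp i j
  ... | tri< i<j _ _ = fwd i<j
  ... | tri≈ _ i≡j _ = contradiction i≡j i≢j
  ... | tri> _ _ j<i = bwd j<i

  uniform⇒homogeneous : {x : Fin m → V} → Uniform _~_ x x → Homogeneous x
  uniform⇒homogeneous {x = x} (inj₁ fwd) = inj₁ clique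
    where
    clique : Clique x
    clique {i} {j} i≢j with Fin.<-cmp i j
    ... | tri< i<j _ _ = fwd i<j
    ... | tri≈ _ i≡j _ = contradiction i≡j i≢j
    ... | tri> _ _ j<i = ~-sym (fwd j<i)
  uniform⇒homogeneous {x = x} (inj₂ fwd) = inj₂ stable
    where
    stable : Stable x
    stable i j with i ≟ j
    ... | yes refl = ~-irrefl
    ... | no  i≢j  = offDiagonal {R = _~_} {x = x} {y = x} fwd (λ i<j → fwd i<j ∘ ~-sym) i≢j

  -- Only adjacency between the two sequences is fixed. Both are injective, since a repeated vertex
  -- would be adjacent to the partners of two indices.
  record Matched (v b : Fin m → V) : Set where
    field
      rung     : ∀ i → v i ~ b i
      off-rung : ∀ {i j} → i ≢ j → ¬ (v i ~ b j)

    ~⇒≡ : ∀ {i j} → v i ~ b j → i ≡ j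
    ~⇒≡ {i} {j} e = decidable-stable (i ≟ j) λ i≢j → off-rung i≢j e

    ≡⇒~ : ∀ {i j} → i ≡ j → v i ~ b j
    ≡⇒~ refl = rung _

    injectiveˡ : Injective _≡_ _≡_ v
    injectiveˡ {_} {j} eq = ~⇒≡ (subst (_~ b j) (sym eq) (rung j))

    injectiveʳ : Injective _≡_ _≡_ b
    injectiveʳ {i} eq = ~⇒≡ (subst (v i ~_) eq (rung i))

  open Matched

  matched-∘ : {v b : Fin m → V} {h : Fin n → Fin m} → Injective _≡_ _≡_ h →
              Matched v b → Matched (v ∘ h) (b ∘ h)
  matched-∘ h-inj M = record { rung = λ i → rung M _ ; off-rung = λ i≢j → off-rung M (i≢j ∘ h-inj) }

  matched-sym : {v b : Fin m → V} → Matched v b → Matched b v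
  matched-sym M = record
    { rung = ~-sym ∘ rung M ; off-rung = λ i≢j → off-rung M (i≢j ∘ sym) ∘ ~-sym }

  -- If `v i` were `b j`, the rung at `i` would join two members of `b`; in the next lemma the rung
  -- at `j` joins two members of `v`.
  stableʳ⇒disjoint : {v b : Fin m → V} → Matched v b → Stable b → ∀ i j → v i ≢ b j
  stableʳ⇒disjoint {b = b} M stable i j eq = stable j i (subst (_~ b i) eq (rung M i))

  stableˡ⇒disjoint : {v b : Fin m → V} → Matched v b → Stable v → ∀ i j → v i ≢ b j
  stableˡ⇒disjoint {v = v} M stable i j eq = stable j i (subst (v j ~_) (sym eq) (rung M j))

-- Obstructions from common neighbours and matchings

Unavoidable : ℕ → Graph → Set₁
Unavoidable n B = ∃ λ H → obstructions n H × H ≤ᵢ B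

module Obstructed (B : Graph) where
  open Graph B using (_~_; ~-sym; ~-irrefl)
  open Sequences (graph B)
  open Matched

  private
    Vertex = Fin (order B)

    -- The position in the list selects the obstruction, and the map may start from its form before
    -- relabelling.
    embedded : (e : Fin m ↔ V) → relabel e H ∈ᴸ _ → H ↪ graph B → Unavoidable n B
    embedded e H∈ f = _ , H∈ , ↪⇒≤ᵢ (↪-trans (relabel-↪ e) f)

  -- The nonadjacent pair is the part `E₂`: a clique of common neighbours gives E₂ + Kₙ, a stable
  -- sequence K₂,ₙ.
  common-neighbours : ∀ {x y} {w : Fin n → Vertex} → x ≢ y → ¬ (x ~ y) →
                      Injective _≡_ _≡_ w → Homogeneous w → (∀ i → x ~ w i) → (∀ i → y ~ w i) →
                      Unavoidable n B
  common-neighbours {x = x} {y} {w} x≢y x≁y w-inj hom x~w y~w = case hom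
    where
    pair = nonadjacent-↪ x≢y x≁y
    pair~w : ∀ k i → to pair k ~ w i
    pair~w zero       = x~w
    pair~w (suc zero) = y~w
    case : Homogeneous w → Unavoidable _ B
    case (inj₁ clique) = embedded +↔⊎ (there (there (there (there (here refl)))))
      (↪-⊹ pair (clique-↪ clique) pair~w)
    case (inj₂ stable) = embedded +↔⊎ (there (there (there (here refl))))
      (↪-⊹ pair (stable-↪ w-inj stable) pair~w)

  pendant-clique : {v b : Fin n → Vertex} → Matched v b → Clique v → Stable b → Unavoidable n B
  pendant-clique M clique stable = embedded +↔⊎ (here refl)
    (↪-glue (clique-↪ clique) (stable-↪ (injectiveʳ M) stable)
      (stableʳ⇒disjoint M stable) (≡⇒~ M) (~⇒≡ M))

  -- Disjointness is assumed because matched cliques can overlap: for an edge xy, take v = (x, y)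
  -- and b = (y, x).
  matched-cliques : {v b : Fin n → Vertex} → Matched v b → Clique v → Clique b →
                    (∀ i j → v i ≢ b j) → Unavoidable n B
  matched-cliques M clique-v clique-b disjoint =
    embedded +↔⊎ (there (there (there (there (there (here refl))))))
      (↪-glue (clique-↪ clique-v) (clique-↪ clique-b) disjoint (≡⇒~ M) (~⇒≡ M))

  -- Index 0 is a spare rung: v 0 is adjacent to every other v i but to no b j with j ≢ 0.
  matched : {v b : Fin (suc n) → Vertex} → Matched v b → Homogeneous v → Homogeneous b →
            Unavoidable n B ⊎ (Stable v × Stable b)
  matched {v = v} M (inj₁ cv) (inj₁ cb) = inj₁ (matched-cliques (matched-∘ Fin.suc-injective M)
    (λ i≢j → cv (i≢j ∘ Fin.suc-injective)) (λ i≢j → cb (i≢j ∘ Fin.suc-injective))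
    λ i j eq → off-rung M {zero} {suc j} (λ ()) (subst (v zero ~_) eq (cv {zero} {suc i} λ ())))
  matched M (inj₁ cv) (inj₂ sb) = inj₁ (pendant-clique (matched-∘ Fin.suc-injective M)
    (λ i≢j → cv (i≢j ∘ Fin.suc-injective)) (λ i j → sb _ _))
  matched M (inj₂ sv) (inj₁ cb) = inj₁ (pendant-clique
    (matched-sym (matched-∘ Fin.suc-injective M))
    (λ i≢j → cb (i≢j ∘ Fin.suc-injective)) (λ i j → sv _ _))
  matched M (inj₂ sv) (inj₂ sb) = inj₂ (sv , sb)

  subdivided-star : ∀ {x} {v b : Fin n → Vertex} → Matched v b → Stable v → Stable b →
                    (∀ i → x ~ v i) → (∀ i → ¬ (x ~ b i)) → (∀ i → x ≢ b i) → Unavoidable n B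
  subdivided-star {n = n} {x = x} {v} {b} M sv sb x~v x≁b x≢b =
    embedded +↔⊎ (there (there (here refl)))
      (↪-glue star (stable-↪ (injectiveʳ M) sb) disjoint joined joined⁻)
    where
    -- In `K*₁,` the pendants are attached to an already relabelled star, with centre at index 0 and
    -- the leaf for `v j` at `suc j`.
    star : graph (relabel (+↔⊎ {1} {n}) (completeBipartite 1 n)) ↪ graph B
    star = ↪-trans (relabel-↪ (+↔⊎ {1} {n})) (↪-⊹ {G = edgeless 1}
      record { to = λ _ → x ; injective = λ { {zero} {zero} _ → refl }
             ; preserves = λ () ; reflects = ~-irrefl }
      (stable-↪ (injectiveˡ M) sv) (λ _ → x~v))
    disjoint : ∀ w i → to star w ≢ b i
    disjoint zero    i = x≢b i
    disjoint (suc j) i = stableˡ⇒disjoint M sv j i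
    joined : ∀ {w i} → w ≡ suc i → to star w ~ b i
    joined refl = rung M _
    joined⁻ : ∀ {w i} → to star w ~ b i → w ≡ suc i
    joined⁻ {zero}  e = contradiction e (x≁b _)
    joined⁻ {suc j} e = cong suc (~⇒≡ M e)

-- Induced paths with uniform adjacencies

uniform-∘ : {R : V → W → Set} {x : Fin m → V} {y : Fin m → W} {h : Fin n → Fin m} →
            (∀ {i j} → i Fin.< j → h i Fin.< h j) → Uniform R x y → Uniform R (x ∘ h) (y ∘ h)
uniform-∘ h-mono (inj₁ fwd) = inj₁ λ i<j → fwd (h-mono i<j)
uniform-∘ h-mono (inj₂ fwd) = inj₂ λ i<j → fwd (h-mono i<j)

inject₁-mono-< : ∀ {i j : Fin n} → i Fin.< j → inject₁ i Fin.< inject₁ j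
inject₁-mono-< {i = i} {j} = subst₂ _<_ (sym (Fin.toℕ-inject₁ i)) (sym (Fin.toℕ-inject₁ j))

inject₁<fromℕ : (i : Fin n) → inject₁ i Fin.< fromℕ n
inject₁<fromℕ zero    = s≤s z≤n
inject₁<fromℕ (suc i) = s≤s (inject₁<fromℕ i)

module Ordered (B : Graph) where
  open Graph B using (_~_; ~-sym; ~-irrefl)
  open Sequences (graph B)
  open Matched
  open Obstructed B

  private
    Vertex = Fin (order B)
    _≁_ : Vertex → Vertex → Set
    x ≁ y = ¬ (x ~ y)

  -- A half graph between `x` and `y` yields a nonadjacent pair with `n` common neighbours: the last
  -- `x` and `y` if `x` is a clique, `x 0` and `y 0` if `x` is stable and `y` a clique, `x 0` and
  -- `x 1` if both are stable.
  crossing : {x y : Fin (2 + n) → Vertex} → (∀ i → x i ≢ y i) → (∀ i → x i ≁ y i) →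
             Homogeneous x → Homogeneous y → Forward _~_ x y → Unavoidable n B
  crossing {n = n} {x} {y} x≢y x≁y (inj₁ clique-x) _ x~y =
    common-neighbours {w = w} (x≢y last) (x≁y last) w-injective (inj₁ clique-w)
      (λ i → clique-x (Fin.fromℕ≢inject₁)) (λ i → ~-sym (x~y (inject₁<fromℕ _)))
    where
    last = fromℕ (suc n)
    w : Fin n → Vertex
    w = x ∘ inject₁ ∘ suc
    clique-w : Clique w
    clique-w i≢j = clique-x (i≢j ∘ Fin.suc-injective ∘ Fin.inject₁-injective)
    w-injective : Injective _≡_ _≡_ w
    w-injective = injective (clique-↪ clique-w)
  crossing {x = x} {y} x≢y x≁y (inj₂ _) (inj₁ clique-y) x~y =
    common-neighbours {w = λ i → y (suc (suc i))} (x≢y zero) (x≁y zero) (injective (clique-↪ clique-w))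
      (inj₁ clique-w) (λ i → x~y (s≤s z≤n)) (λ i → clique-y λ ())
    where
    clique-w : Clique (λ i → y (suc (suc i)))
    clique-w i≢j = clique-y (i≢j ∘ Fin.suc-injective ∘ Fin.suc-injective)
  crossing {x = x} {y} x≢y x≁y (inj₂ stable-x) (inj₂ stable-y) x~y =
    common-neighbours {w = λ i → y (suc (suc i))}
      -- `y 1` is adjacent to `x 0` but not to `x 1`, so these two differ.
      (λ eq → x≁y (suc zero) (subst (_~ y (suc zero)) eq (x~y (s≤s z≤n)))) (stable-x _ _)
      (Fin.suc-injective ∘ Fin.suc-injective ∘ y-injective)
      (inj₂ λ i j → stable-y _ _) (λ i → x~y (s≤s z≤n)) (λ i → x~y (s≤s (s≤s z≤n)))
    where
    y-injective : Injective _≡_ _≡_ y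
    y-injective = increasing⇒injective λ {i} {j} i<j eq → x≁y i (subst (x i ~_) (sym eq) (x~y i<j))

  matching : {v b : Fin m → Vertex} → (∀ i → v i ~ b i) →
             Forward _≁_ v b → Forward _≁_ b v → Matched v b
  matching {v = v} {b} v~b v≁b b≁v = record
    { rung = v~b ; off-rung = offDiagonal {R = _~_} {x = v} {y = b} v≁b (λ i<j → b≁v i<j ∘ ~-sym) }

  -- If `v` is joined forward to `b`, the last `b` shares with `x` all earlier `v i`; if `b` is
  -- joined forward to `v`, then `b 0` shares with `x` all later ones. Otherwise `v` and `b` are
  -- matched, and if both are stable, `x` is the centre of a subdivided star. Each case spends one
  -- index.
  fan : ∀ {x} {v b : Fin (suc n) → Vertex} → Injective _≡_ _≡_ v →
        Homogeneous v → Homogeneous b → (∀ i → x ~ v i) → (∀ i → x ≁ b i) → (∀ i → x ≢ b i) →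
        (∀ i → v i ~ b i) → Uniform _~_ v b → Uniform _~_ b v → Unavoidable n B
  fan {n = n} v-inj hom-v hom-b x~v x≁b x≢b v~b (inj₁ fwd) _ =
    common-neighbours (x≢b (fromℕ n)) (x≁b (fromℕ n)) (Fin.inject₁-injective ∘ v-inj)
      (homogeneous-∘ Fin.inject₁-injective hom-v) (λ i → x~v _) (λ i → ~-sym (fwd (inject₁<fromℕ i)))
  fan v-inj hom-v hom-b x~v x≁b x≢b v~b (inj₂ _) (inj₁ fwd) =
    common-neighbours (x≢b zero) (x≁b zero) (Fin.suc-injective ∘ v-inj)
      (homogeneous-∘ Fin.suc-injective hom-v) (λ i → x~v _) (λ i → fwd (s≤s z≤n))
  fan v-inj hom-v hom-b x~v x≁b x≢b v~b (inj₂ v≁b) (inj₂ b≁v) with matching v~b v≁b b≁v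
  ... | M with matched M hom-v hom-b
  ...   | inj₁ found     = found
  ...   | inj₂ (sv , sb) = subdivided-star (matched-∘ Fin.suc-injective M)
    (λ i j → sv _ _) (λ i j → sb _ _) (λ i → x~v _) (λ i → x≁b _) (λ i → x≢b _)

  -- An edge pattern between `a` and `v` away from the diagonal makes `a 0` or the last `a` the apex
  -- of a fan. The index of the apex is dropped, leaving the `suc n` indices that `fan` takes.
  matched-or-fan : {a v b : Fin (2 + n) → Vertex} → Injective _≡_ _≡_ v →
                   Homogeneous v → Homogeneous b →
                   (∀ i → v i ~ a i) → (∀ i → v i ~ b i) →
                   (∀ i j → a i ≁ b j) → (∀ i j → a i ≢ b j) →
                   Uniform _~_ a v → Uniform _~_ v a → Uniform _~_ v b → Uniform _~_ b v →
                   Unavoidable n B ⊎ Matched v a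
  matched-or-fan {a = a} {v} v-inj hom-v hom-b v~a v~b a≁b a≢b (inj₁ a~v) _ vb bv =
    inj₁ (fan {x = a zero} (Fin.suc-injective ∘ v-inj)
      (homogeneous-∘ Fin.suc-injective hom-v) (homogeneous-∘ Fin.suc-injective hom-b)
      (λ i → a~v (s≤s z≤n)) (λ i → a≁b _ _) (λ i → a≢b _ _) (v~b ∘ suc)
      (uniform-∘ {R = _~_} s≤s vb) (uniform-∘ {R = _~_} s≤s bv))
  matched-or-fan {n = n} {a} {v} v-inj hom-v hom-b v~a v~b a≁b a≢b (inj₂ _) (inj₁ fwd) vb bv =
    inj₁ (fan {x = a (fromℕ (suc n))} (Fin.inject₁-injective ∘ v-inj)
      (homogeneous-∘ Fin.inject₁-injective hom-v) (homogeneous-∘ Fin.inject₁-injective hom-b)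
      (λ i → ~-sym (fwd (inject₁<fromℕ i))) (λ i → a≁b _ _) (λ i → a≢b _ _) (v~b ∘ inject₁)
      (uniform-∘ {R = _~_} inject₁-mono-< vb) (uniform-∘ {R = _~_} inject₁-mono-< bv))
  matched-or-fan v-inj hom-v hom-b v~a v~b a≁b a≢b (inj₂ a≁v) (inj₂ v≁a) vb bv =
    inj₂ (matching v~a v≁a a≁v)

  -- By `matched`, a clique among the left, middle or right vertices already gives an obstruction.
  -- If all three sequences are stable, distinct paths have no edges between them and form nP₃.
  disjoint-paths : (p : Fin (suc n) → path 3 ↪ graph B) →
                   let x = λ k i → to (p i) k in
                   (∀ k → Homogeneous (x k)) →
                   Matched (x middle) (x left) → Matched (x middle) (x right) →
                   (∀ i j → x left i ≁ x right j) → Unavoidable n B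
  disjoint-paths p hom Mˡ Mʳ l≁r
    with matched Mˡ (hom middle) (hom left) | matched Mʳ (hom middle) (hom right)
  ... | inj₁ found     | _              = found
  ... | inj₂ _         | inj₁ found     = found
  ... | inj₂ (sm , sl) | inj₂ (_ , sr) = _ , there (here refl) , ↪⇒≤ᵢ (↪-trans (relabel-↪ *↔×)
    (↪-copies (p ∘ suc) neighbour λ i≢j u w → apart (i≢j ∘ Fin.suc-injective) u w))
    where
    neighbour : ∀ u → ∃ λ w → SimpleGraph._~_ (path 3) w u
    neighbour left   = middle , inj₂ refl
    neighbour middle = left , inj₁ refl
    neighbour right  = middle , inj₁ refl
    apart : ∀ {i j} → i ≢ j → ∀ u w → to (p i) u ≁ to (p j) w
    apart i≢j left   left   = sl _ _
    apart i≢j left   middle = off-rung Mˡ (i≢j ∘ sym) ∘ ~-sym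
    apart i≢j left   right  = l≁r _ _
    apart i≢j middle left   = off-rung Mˡ i≢j
    apart i≢j middle middle = sm _ _
    apart i≢j middle right  = off-rung Mʳ i≢j
    apart i≢j right  left   = l≁r _ _ ∘ ~-sym
    apart i≢j right  middle = off-rung Mʳ (i≢j ∘ sym) ∘ ~-sym
    apart i≢j right  right  = sr _ _

  -- If x 0 ≡ y 1 ≡ y 2 and x 1 ≡ y 2, then x 1 ≡ y 1.
  disjoint : {x y : Fin (3 + n) → Vertex} → (∀ i → x i ≢ y i) →
             Uniform _≡_ x y → Uniform _≡_ y x → ∀ i j → x i ≢ y j
  disjoint x≢y (inj₁ x≡y) _ i j _ =
    x≢y (suc zero) (trans (x≡y {suc zero} {suc (suc zero)} (s≤s (s≤s z≤n)))
      (trans (sym (x≡y {zero} {suc (suc zero)} (s≤s z≤n))) (x≡y {zero} {suc zero} (s≤s z≤n))))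
  disjoint x≢y (inj₂ _) (inj₁ y≡x) i j _ =
    x≢y (suc zero) (sym (trans (y≡x {suc zero} {suc (suc zero)} (s≤s (s≤s z≤n)))
      (trans (sym (y≡x {zero} {suc (suc zero)} (s≤s z≤n))) (y≡x {zero} {suc zero} (s≤s z≤n)))))
  disjoint {x = x} {y} x≢y (inj₂ x≢y′) (inj₂ y≢x) i j eq with i ≟ j
  ... | yes refl = x≢y i eq
  ... | no  i≢j  = offDiagonal {R = _≡_} {x = x} {y = y} x≢y′ (λ i<j → y≢x i<j ∘ sym) i≢j eq

  -- `matched-or-fan` is applied once to each end, with the other end in the role of `b`. If neither
  -- finds a fan, the middles are matched to both ends.
  nonadjacent-ends : (p : Fin (2 + n) → path 3 ↪ graph B) →
                     let x = λ k i → to (p i) k in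
                     Injective _≡_ _≡_ (x middle) → (∀ k l → Uniform _~_ (x k) (x l)) →
                     (∀ i j → x left i ≁ x right j) → (∀ i j → x left i ≢ x right j) →
                     Unavoidable n B
  nonadjacent-ends p m-inj adj l≁r l≢r
    with matched-or-fan m-inj (hom middle) (hom right) m~l m~r l≁r l≢r
           (adj left middle) (adj middle left) (adj middle right) (adj right middle)
       | matched-or-fan m-inj (hom middle) (hom left) m~r m~l
           (λ i j → l≁r j i ∘ ~-sym) (λ i j → l≢r j i ∘ sym)
           (adj right middle) (adj middle right) (adj middle left) (adj left middle)
    where
    hom = λ k → uniform⇒homogeneous (adj k k)
    m~l = λ i → ~-sym (left~middle (p i))
    m~r = λ i → middle~right (p i)
  ... | inj₁ found | _          = found
  ... | inj₂ _     | inj₁ found = found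
  ... | inj₂ Mˡ    | inj₂ Mʳ    = disjoint-paths (p ∘ suc)
    (λ k → homogeneous-∘ Fin.suc-injective (uniform⇒homogeneous (adj k k)))
    (matched-∘ Fin.suc-injective Mˡ) (matched-∘ Fin.suc-injective Mʳ) (λ i j → l≁r _ _)

  -- `disjoint` works with at least three indices, and `crossing` and `nonadjacent-ends` spend two;
  -- writing the parameter as `suc n` makes `3 + n` fit both.
  uniform⇒unavoidable : (p : Fin (3 + n) → path 3 ↪ graph B) →
                        let x = λ k i → to (p i) k in
                        Injective _≡_ _≡_ (x middle) →
                        (∀ k l → Uniform _~_ (x k) (x l)) → (∀ k l → Uniform _≡_ (x k) (x l)) →
                        Unavoidable (suc n) B
  uniform⇒unavoidable p m-inj adj eq with adj left right | adj right left
  ... | inj₁ l~r | _        = crossing (left≢right ∘ p) (left≁right ∘ p)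
    (uniform⇒homogeneous (adj left left)) (uniform⇒homogeneous (adj right right)) l~r
  ... | inj₂ _   | inj₁ r~l = crossing
    (λ i → left≢right (p i) ∘ sym) (λ i → left≁right (p i) ∘ ~-sym)
    (uniform⇒homogeneous (adj right right)) (uniform⇒homogeneous (adj left left)) r~l
  ... | inj₂ l≁r | inj₂ r≁l = nonadjacent-ends p m-inj adj apart
    (disjoint (left≢right ∘ p) (eq left right) (eq right left))
    where
    apart : ∀ i j → to (p i) left ≁ to (p j) right
    apart i j with i ≟ j
    ... | yes refl = left≁right (p i)
    ... | no  i≢j  = offDiagonal {R = _~_} {x = λ i → to (p i) left} {y = λ i → to (p i) right}
                       l≁r (λ i<j → r≁l i<j ∘ ~-sym) i≢j

-- Ramsey's theorem applied to many induced paths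

Colour : Set
Colour = Bool × Fin 3 × Fin 3

-- Quantifying over the enumeration cs keeps the Ramsey number from being evaluated.
manyCentres⇒unavoidable : (cs : List Colour) → (∀ c → c ∈ᴸ cs) → (B : Graph) →
                          iteratedRamseyNumber (length cs) (3 + n) ≤ k →
                          {c : Fin k → Fin (order B)} → Injective _≡_ _≡_ c →
                          (∀ i → IsCentre (graph B) (c i)) → Unavoidable (suc n) B
manyCentres⇒unavoidable {n = n} {k = k} cs complete-cs B large {c} c-inj centre
  with uniformSubsequence coloured? cs (3 + n) large
  where
  open Graph B using (_~_; _~?_)
  x : Fin 3 → Fin k → Fin (order B)
  x k i = to (proj₁ (centre i)) k
  -- A colour picks adjacency or equality, a vertex `k` of the first path and a vertex `l` of the
  -- second. Both orders of `k` and `l` occur, as uniformity only sees increasing pairs.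
  Coloured : Colour → Rel (Fin k) 0ℓ
  Coloured (true  , k , l) i j = x k i ~ x l j
  Coloured (false , k , l) i j = x k i ≡ x l j
  coloured? : ∀ c → Decidable (Coloured c)
  coloured? (true  , k , l) i j = x k i ~? x l j
  coloured? (false , k , l) i j = x k i ≟ x l j
... | t , t-inj , uniform = Ordered.uniform⇒unavoidable B (λ i → proj₁ (centre (t i)))
  (λ {i} {j} eq → t-inj (c-inj
    (trans (sym (proj₂ (centre (t i)))) (trans eq (proj₂ (centre (t j)))))))
  (λ k l → uniform (complete-cs (true , k , l))) (λ k l → uniform (complete-cs (false , k , l)))

colours : List Colour
colours = cartesianProduct (true ∷ false ∷ []) (cartesianProduct (allFin 3) (allFin 3))

∈-colours : ∀ c → c ∈ᴸ colours
∈-colours (b , k , l) = ∈-cartesianProduct⁺ (bool b) (∈-cartesianProduct⁺ (∈-allFin k) (∈-allFin l))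
  where
  bool : ∀ b → b ∈ᴸ true ∷ false ∷ []
  bool true  = here refl
  bool false = there (here refl)

unavoidableBound : (cs : List Colour) → (∀ c → c ∈ᴸ cs) → ∀ n →
                   ∃ λ C → ∀ B → C ≤ ∣ ⟨ branching? B ⟩ ∣ → Unavoidable (suc n) B
unavoidableBound cs complete-cs n = iteratedRamseyNumber (length cs) (3 + n) , λ B C≤ →
  let f , f-inj , f∈ = ≤∣∣⇒injection _ C≤
  in manyCentres⇒unavoidable cs complete-cs B ℕ.≤-refl f-inj λ i →
       branching⇒centre B (∈⟨⟩⁻ (branching? B) (f∈ i))

-- Centres in the obstructions

-- Supplies a second clique vertex, from which an induced path runs through `i` to the pendant or
-- partner of `i`.
other : Fin (2 + n) → Fin (2 + n)
other zero    = suc zero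
other (suc _) = zero

other≢ : (i : Fin (2 + n)) → other i ≢ i
other≢ zero    ()
other≢ (suc _) ()

record Centres (n : ℕ) (B : Graph) : Set where
  constructor centres
  field
    centre           : Fin n → Fin (order B)
    centre-injective : Injective _≡_ _≡_ centre
    isCentre         : ∀ i → IsCentre (graph B) (centre i)

relabel-centres : (e : Fin m ↔ V) (G : SimpleGraph V) {c : Fin n → V} → Injective _≡_ _≡_ c →
                  (∀ i → IsCentre G (c i)) → Centres n (relabel e G)
relabel-centres e G {c} c-inj isCentre =
  centres (to f ∘ c) (c-inj ∘ injective f) (centre-↪ f ∘ isCentre)
  where f = ↪-relabel {G = G} e

-- The centres are the clique vertices of Kₙ*, the middles in nP₃, the leaves of the star in K*₁,ₙ,
-- the common neighbours of the nonadjacent pair in K₂,ₙ and E₂ + Kₙ, and one of the two cliques of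
-- CKₙ.
obstruction-centres : ∀ H → obstructions (2 + n) H → Centres (2 + n) H
obstruction-centres {n} _ (here refl) =
  relabel-centres +↔⊎ Γ inj₁-injective λ i →
    P₃ Γ {inj₁ (other i)} {inj₁ i} {inj₂ i} (other≢ i) refl (λ ()) (other≢ i) , refl
  where Γ = attachPendants _≟_ id (complete (2 + n))
obstruction-centres {n} _ (there (here refl)) =
  relabel-centres *↔× Γ {λ i → i , middle} (cong proj₁) λ i →
    P₃ Γ {i , left} {i , middle} {i , right} (refl , inj₁ refl) (refl , inj₁ refl)
      (λ ()) (λ { (_ , inj₁ ()) ; (_ , inj₂ ()) }) , refl
  where Γ = copies (2 + n) (path 3)
obstruction-centres {n} _ (there (there (here refl))) =
  relabel-centres +↔⊎ Γ {inj₁ ∘ suc} (Fin.suc-injective ∘ inj₁-injective) λ i →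
    P₃ Γ {inj₁ zero} {inj₁ (suc i)} {inj₂ i} _ refl (λ ()) (λ ()) , refl
  -- The map `leaf` in `K*₁,` computes to `suc`.
  where Γ = attachPendants _≟_ suc (graph (relabel (+↔⊎ {1}) (completeBipartite 1 (2 + n))))
obstruction-centres {n} _ (there (there (there (here refl)))) =
  relabel-centres +↔⊎ Γ inj₂-injective λ i →
    P₃ Γ {inj₁ zero} {inj₂ i} {inj₁ (suc zero)} _ _ (λ ()) id , refl
  where Γ = completeBipartite 2 (2 + n)
obstruction-centres {n} _ (there (there (there (there (here refl))))) =
  relabel-centres +↔⊎ Γ inj₂-injective λ i →
    P₃ Γ {inj₁ zero} {inj₂ i} {inj₁ (suc zero)} _ _ (λ ()) id , refl
  where Γ = edgeless 2 ⊹ complete (2 + n)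
obstruction-centres {n} _ (there (there (there (there (there (here refl)))))) =
  relabel-centres +↔⊎ Γ inj₁-injective λ i →
    P₃ Γ {inj₁ (other i)} {inj₁ i} {inj₂ i} (other≢ i) refl (λ ()) (other≢ i) , refl
  where Γ = glue (complete (2 + n)) (complete (2 + n)) _≟_

-- The two directions of the equivalence

corollary4p2 : ∀ {ℓ : Level} → ExcludedMiddle (lsuc 0ℓ ⊔ ℓ) →
    (𝓗 : Family ℓ) →
    (∃ λ (C : ℕ) → ∀ (G : Graph) → 𝓗 -free G →
    ∣ ⟨ (λ v → 2 ≤? α G (N G v)) ⟩ ∣ ≤ C)
    ⇔
    (∃ λ (n : ℕ) → n ≥ 1 × 𝓗 ≤ᶠ obstructions n)
corollary4p2 em 𝓗 = mk⇔ bounded⇒≤ᶠ ≤ᶠ⇒bounded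
  where
  bounded⇒≤ᶠ : _ → _
  -- An obstruction containing no member of `𝓗` would be `𝓗`-free with at least `2 + C` centres. The
  -- 2 provides the second clique vertex of `other` as well as exceeding `C`. As `𝓗` is an arbitrary
  -- predicate, extracting the member takes excluded middle.
  bounded⇒≤ᶠ (C , bounded) = 2 + C , s≤s z≤n , λ H H∈ → decidable-stable em λ free →
    ℕ.<⇒≱ (ℕ.≤-trans (ℕ.n≤1+n (suc C)) (count (obstruction-centres H H∈))) (bounded H free)
    where
    count : ∀ {n H} → Centres n H → n ≤ ∣ ⟨ branching? H ⟩ ∣
    count {H = H} (centres c c-inj isCentre) =
      injection⇒≤∣∣ _ c c-inj λ i → ∈⟨⟩⁺ (branching? H) (centre⇒branching H (isCentre i))
  -- More than `C` centres force an obstruction in `G`, hence by transitivity a member of `𝓗`.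
  avoided : ∀ {n C} → 𝓗 ≤ᶠ obstructions n →
            (∀ G → C ≤ ∣ ⟨ branching? G ⟩ ∣ → Unavoidable n G) →
            ∀ G → 𝓗 -free G → ∣ ⟨ branching? G ⟩ ∣ ≤ C
  avoided 𝓗≤ unavoidable G free = ℕ.≮⇒≥ λ C< →
    let H₂ , H₂∈ , H₂≤G  = unavoidable G (ℕ.<⇒≤ C<)
        H₁ , H₁∈ , H₁≤H₂ = 𝓗≤ H₂ H₂∈
    in free (H₁ , H₁∈ , ↪⇒≤ᵢ (↪-trans (≤ᵢ⇒↪ {H₁} {H₂} H₁≤H₂) (≤ᵢ⇒↪ {H₂} {G} H₂≤G)))
  ≤ᶠ⇒bounded : _ → _
  -- `n ≥ 1` rules out zero, and `unavoidableBound` at `n` concerns the obstructions of parameter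
  -- `suc n`.
  ≤ᶠ⇒bounded (suc n , _ , 𝓗≤) = map₂ (avoided 𝓗≤) (unavoidableBound colours ∈-colours n)
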